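{- Let $z\ge 1$, $r\ge 1$ and $g\ge 3$ be integers. Then there exists a $[z,r;g]$-mixed graph.
   Context: A mixed graph is a finite graph that may contain both (undirected) edges and (directed) arcs. A $[z,r;g]$-mixed graph is a mixed graph in which every vertex is the tail of exactly $z$ arcs, the head of exactly $z$ arcs, and is incident with exactly $r$ edges, and whose girth is $g$. Walks are sequences $(v_0,\dots,v_n)$ where for each $i$, $v_iv_{i+1}$ is an edge or $(v_i,v_{i+1})$ is an arc (arcs may only be traversed in their direction, edges in either direction); a cycle is a closed such walk with no repeated vertex other than $v_0=v_n$ and no edge or arc used twice; the girth is the length of a shortest cycle. -}

module Defs where

open import Data.Bool.Base using (Bool; false; T)
open import Data.Empty using (⊥)
open import Data.Fin.Base using (Fin; zero; suc; inject₁; fromℕ)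
open import Data.Fin.Subset using (∣_∣)
open import Data.Nat.Base using (ℕ; _≤_)
open import Data.Product.Base using (_×_)
open import Data.Sum.Base using (_⊎_)
open import Data.Vec.Base using (tabulate)
open import Function.Definitions using (Injective)
open import Relation.Binary.PropositionalEquality using (_≡_; _≢_)
open import Relation.Nullary.Negation using (¬_)

-- Simple mixed graphs: no loops, at most one edge on each pair of vertices, and
-- at most one arc on each ordered pair.  Opposite arcs, or an edge together
-- with an arc on the same pair, are allowed; they create cycles of length 2.
record MixedGraph : Set where
  field
    order : ℕ

  Vertex : Set
  Vertex = Fin order

  field
    edge        : Vertex → Vertex → Bool
    arc         : Vertex → Vertex → Bool
    edge-sym    : ∀ u v → edge u v ≡ edge v u
    edge-irrefl : ∀ v → edge v v ≡ false
    arc-irrefl  : ∀ v → arc v v ≡ false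

  degree outdegree indegree : Vertex → ℕ
  degree    v = ∣ tabulate (λ w → edge v w) ∣
  outdegree v = ∣ tabulate (λ w → arc v w) ∣
  indegree  v = ∣ tabulate (λ w → arc w v) ∣

module _ (G : MixedGraph) where
  open MixedGraph G

  data Step (u v : Vertex) : Set where
    along-edge : T (edge u v) → Step u v
    along-arc  : T (arc u v) → Step u v

  -- Two steps use the same edge or the same arc; an edge may be used in
  -- either direction.
  SameLink : ∀ {u v u′ v′} → Step u v → Step u′ v′ → Set
  SameLink {u} {v} {u′} {v′} (along-edge _) (along-edge _) =
    (u ≡ u′ × v ≡ v′) ⊎ (u ≡ v′ × v ≡ u′)
  SameLink {u} {v} {u′} {v′} (along-arc _) (along-arc _) = u ≡ u′ × v ≡ v′
  SameLink (along-edge _) (along-arc _)  = ⊥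
  SameLink (along-arc _)  (along-edge _) = ⊥

  -- The steps are recorded along with the vertices, since the vertices alone do
  -- not determine which link is used when an edge uv and an arc (u,v) coexist.
  record Walk (n : ℕ) : Set where
    field
      vertex : Fin (ℕ.suc n) → Vertex
      step   : (i : Fin n) → Step (vertex (inject₁ i)) (vertex (suc i))

  record Cycle (n : ℕ) : Set where
    field
      walk : Walk n
    open Walk walk public
    field
      positive         : 1 ≤ n
      closed           : vertex zero ≡ vertex (fromℕ n)
      -- v₀, …, vₙ₋₁ are pairwise distinct
      vertex-injective : Injective _≡_ _≡_ (λ (i : Fin n) → vertex (inject₁ i))
      links-distinct   : ∀ i j → i ≢ j → ¬ SameLink (step i) (step j)

  HasGirth : ℕ → Set
  HasGirth g = Cycle g × (∀ n → Cycle n → g ≤ n)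

record IsMixedGraph[_,_⨾_] (z r g : ℕ) (G : MixedGraph) : Set where
  open MixedGraph G
  field
    out-regular  : ∀ v → outdegree v ≡ z
    in-regular   : ∀ v → indegree v ≡ z
    edge-regular : ∀ v → degree v ≡ r
    girth        : HasGirth G g

{-# OPTIONS --safe #-}

-- The vertices are triples (level, index, height) with level in ℤ/g, index in a
-- set of z elements, and height a vertex of an r-regular graph H of girth at
-- least g.  Edges follow H and fix level and index; arcs go to every vertex of
-- the next level with the same height.  A cycle which uses an arc then uses a
-- positive multiple of g arcs, and all other cycles live in a copy of H.
--
-- H is properly edge-coloured by r involutions and obtained from a single point
-- (with loops) by repeatedly passing to the cover whose fibres are ℤ/2-valued
-- functions on the coloured edges, where following an edge toggles its
-- coordinate.  A closed walk in the cover uses every edge an even number of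
-- times, whereas a shortest closed reduced walk in the base uses its first edge
-- only once; hence every cover increases the girth.
module Submission where

open import Data.Bool.Base using (Bool; true; false; T)
open import Data.Fin.Base using (Fin; zero; suc; toℕ; fromℕ; inject₁; combine; quotient; remainder; finToFun; funToFin; opposite)
open import Data.Fin.Properties using (_≟_; any?; combine-injective; combine-remQuot; remQuot-combine; finToFun-funToFin; funToFin-finToFin; opposite-involutive; injective⇒≤; inject₁-injective; suc-injective; fromℕ≢inject₁; toℕ-inject₁; toℕ-fromℕ)
open import Data.Fin.Relation.Unary.Top using (view; ‵fromℕ; ‵inject₁)
open import Data.Fin.Subset using (∣_∣)
open import Data.Nat.Base using (ℕ; zero; suc; _+_; _*_; _^_; _≤_; _<_; _≥_; z≤n; s≤s; z<s; s<s; s<s⁻¹)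
open import Data.Nat.Properties using (≤-refl; ≤-reflexive; ≤-trans; ≤-antisym; <⇒≤; ≰⇒>; n<1+n; m≤n⇒m≤1+n; m≤n⇒m<n∨m≡n; m≤m+n; +-suc; +-assoc; +-comm; +-cancelˡ-≡; _≤?_)
open import Data.Product.Base using (∃; ∃₂; _×_; _,_; proj₁; proj₂; uncurry)
open import Data.Sum.Base using (_⊎_; inj₁; inj₂; swap)
open import Data.Unit.Base using (tt)
open import Data.Vec.Base using (tabulate)
open import Function.Base using (_∘_)
open import Function.Bundles using (mk⇔)
open import Function.Definitions using (Injective)
open import Relation.Binary.PropositionalEquality using (_≡_; _≢_; _≗_; refl; sym; trans; cong; cong₂; subst; module ≡-Reasoning)
open import Relation.Nullary using (Dec; yes; no; ¬_; contradiction)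
open import Relation.Nullary.Decidable using (_×-dec_; _⊎-dec_; ⌊_⌋; toWitness; fromWitness; isYes≗does; does-⇔; dec-false)
open import Defs

-- Toggling bits

funToFin-cong : ∀ {m n} {f g : Fin m → Fin n} → f ≗ g → funToFin f ≡ funToFin g
funToFin-cong {zero}  eq = refl
funToFin-cong {suc m} eq = cong₂ combine (eq zero) (funToFin-cong (eq ∘ suc))

opposite-≢ : (b : Fin 2) → opposite b ≢ b
opposite-≢ zero       ()
opposite-≢ (suc zero) ()

toggle : ∀ {p} {P : Set p} → Dec P → Fin 2 → Fin 2
toggle (yes _) = opposite
toggle (no _)  = λ b → b

toggle-yes : ∀ {p} {P : Set p} (P? : Dec P) → P → ∀ b → toggle P? b ≢ b
toggle-yes (yes _) _ = opposite-≢
toggle-yes (no ¬p) p = contradiction p ¬p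

toggle-no : ∀ {p} {P : Set p} (P? : Dec P) → ¬ P → ∀ b → toggle P? b ≡ b
toggle-no (yes p) ¬p = contradiction p ¬p
toggle-no (no _)  _  = λ _ → refl

toggle-twice : ∀ {p q} {P : Set p} {Q : Set q} (P? : Dec P) (Q? : Dec Q) →
               (P → Q) → (Q → P) → ∀ b → toggle P? (toggle Q? b) ≡ b
toggle-twice (yes _) (yes _) _ _ = opposite-involutive
toggle-twice (yes p) (no ¬q) f _ = contradiction (f p) ¬q
toggle-twice (no ¬p) (yes q) _ g = contradiction (g q) ¬p
toggle-twice (no _)  (no _)  _ _ = λ _ → refl

-- Edge-coloured regular graphs given by involutions

record Involutions (r : ℕ) : Set where
  field
    order           : ℕ
    -- Keeps the graph nonempty; the cycle realising the girth runs at this height.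
    basepoint       : Fin order
    move            : Fin r → Fin order → Fin order
    move-involutive : ∀ c v → move c (move c v) ≡ v

  -- The sequences are total on ℕ and constrained only below `n`, so that a prefix of a walk is
  -- given by the same sequences and a tail by composing them with `suc`.
  IsWalk : (ℕ → Fin order) → (ℕ → Fin r) → ℕ → Set
  IsWalk u c n = ∀ i → i < n → u (suc i) ≡ move (c i) (u i)

  IsReduced : (ℕ → Fin r) → ℕ → Set
  IsReduced c n = ∀ i → suc i < n → c i ≢ c (suc i)

  -- No reduced colour word of length 0 < n < g fixes a point; for g ≥ 3 this
  -- includes that the involutions are fixed-point free and pairwise different
  -- at every point.
  Free : ℕ → Set
  Free g = ∀ u c n → suc n < g → IsWalk u c (suc n) → IsReduced c (suc n) → u 0 ≢ u (suc n)

-- The cover by bit functions on the coloured edges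

module _ {r : ℕ} (H : Involutions r) where
  open Involutions H

  private
    Fibre : ℕ
    Fibre = 2 ^ (order * r)

  -- Moving along the edge {v , move c v} of colour c toggles the two coordinates
  -- which represent that edge (a single one if the edge is a loop).
  OnEdge : Fin r → Fin order → Fin (order * r) → Set
  OnEdge c v e = e ≡ combine v c ⊎ e ≡ combine (move c v) c

  onEdge? : ∀ c v e → Dec (OnEdge c v e)
  onEdge? c v e = (e ≟ combine v c) ⊎-dec (e ≟ combine (move c v) c)

  onEdge-move : ∀ c v e → OnEdge c (move c v) e → OnEdge c v e
  onEdge-move c v e rewrite move-involutive c v = swap

  onEdge-move⁻ : ∀ c v e → OnEdge c v e → OnEdge c (move c v) e
  onEdge-move⁻ c v e rewrite move-involutive c v = swap

  toggleEdge : Fin r → Fin order → (Fin (order * r) → Fin 2) → Fin (order * r) → Fin 2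
  toggleEdge c v φ e = toggle (onEdge? c v e) (φ e)

  point : Fin (order * Fibre) → Fin order
  point = quotient Fibre

  bits : Fin (order * Fibre) → Fin (order * r) → Fin 2
  bits = finToFun ∘ remainder {order} Fibre

  lift : Fin order → (Fin (order * r) → Fin 2) → Fin (order * Fibre)
  lift v φ = combine v (funToFin φ)

  point-lift : ∀ v φ → point (lift v φ) ≡ v
  point-lift v φ = cong proj₁ (remQuot-combine {order} v (funToFin φ))

  bits-lift : ∀ v φ → bits (lift v φ) ≗ φ
  bits-lift v φ e = trans (cong (λ p → finToFun (proj₂ p) e) (remQuot-combine {order} v (funToFin φ)))
                          (finToFun-funToFin φ e)

  lift-cong : ∀ {v w φ ψ} → v ≡ w → φ ≗ ψ → lift v φ ≡ lift w ψ
  lift-cong v≡w φ≗ψ = cong₂ combine v≡w (funToFin-cong φ≗ψ)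

  lift-point-bits : ∀ x → lift (point x) (bits x) ≡ x
  lift-point-bits x = trans (cong (combine (point x)) (funToFin-finToFin {order * r} {2} (remainder {order} Fibre x)))
                            (combine-remQuot {order} Fibre x)

  coverMove : Fin r → Fin (order * Fibre) → Fin (order * Fibre)
  coverMove c x = lift (move c (point x)) (toggleEdge c (point x) (bits x))

  point-coverMove : ∀ c x → point (coverMove c x) ≡ move c (point x)
  point-coverMove c x = point-lift _ (toggleEdge c (point x) (bits x))

  bits-coverMove : ∀ c x → bits (coverMove c x) ≗ toggleEdge c (point x) (bits x)
  bits-coverMove c x = bits-lift (move c (point x)) _

  -- Going back along an edge toggles the same coordinates as going forth, because its two ends name
  -- the same pair in swapped order; the toggles cancel.
  coverMove-involutive : ∀ c x → coverMove c (coverMove c x) ≡ x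
  coverMove-involutive c x = trans (lift-cong eqᵖ eqᵇ) (lift-point-bits x)
    where
    y = coverMove c x
    eqᵖ : move c (point y) ≡ point x
    eqᵖ = trans (cong (move c) (point-coverMove c x)) (move-involutive c (point x))
    eqᵇ : toggleEdge c (point y) (bits y) ≗ bits x
    eqᵇ e rewrite point-coverMove c x | bits-coverMove c x e =
      toggle-twice (onEdge? c (move c (point x)) e) (onEdge? c (point x) e)
                   (onEdge-move c (point x) e) (onEdge-move⁻ c (point x) e) (bits x e)

  cover : Involutions r
  cover = record
    { order           = order * Fibre
    ; basepoint       = lift basepoint (λ _ → zero)
    ; move            = coverMove
    ; move-involutive = coverMove-involutive
    }

  open Involutions cover using () renaming (IsWalk to IsWalkᶜ; Free to Freeᶜ)

  point-walk : ∀ {u c n} → IsWalkᶜ u c n → IsWalk (point ∘ u) c n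
  point-walk {u} {c} w i i<n = trans (cong point (w i i<n)) (point-coverMove (c i) (u i))

  -- On a closed walk of length g in H the first edge is never used again, so its
  -- coordinate is toggled exactly once along a lift of that walk.
  module _ {g} (free : Free (suc g)) where

    edge-not-reused : ∀ u c → IsWalk u c (suc g) → IsReduced c (suc g) →
                      ∀ i → i < g → ¬ OnEdge (c (suc i)) (u (suc i)) (combine (u 0) (c 0))
    -- Same direction: `u 0` recurs at time `suc i`, which closes a reduced walk of length at most
    -- `g`.
    edge-not-reused u c walk red i i<g (inj₁ e) =
      free u c i (s<s i<g) (λ j j≤i → walk j (≤-trans j≤i (s≤s (<⇒≤ i<g))))
           (λ j j<i → red j (≤-trans j<i (s≤s (<⇒≤ i<g))))
           (proj₁ (combine-injective _ _ _ _ e))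
    -- Opposite direction: the step leads back to `u 0` and closes a walk of length `2 + i`, which
    -- is too short unless this is the last step.
    edge-not-reused u c walk red i i<g (inj₂ e) with combine-injective _ _ _ _ e
    ... | u≡ , c≡ with m≤n⇒m<n∨m≡n i<g
    ... | inj₁ 1+i<g =
      free u c (suc i) (s<s 1+i<g) (λ j j<i → walk j (≤-trans j<i (s≤s i<g)))
           (λ j j<i → red j (≤-trans j<i (s≤s i<g)))
           (trans u≡ (sym (walk (suc i) (s<s i<g))))
    -- There are only two steps and they have the same colour, so the walk is not reduced.
    edge-not-reused u c walk red zero i<g (inj₂ _) | u≡ , c≡ | inj₂ refl = red 0 (s<s i<g) c≡
    -- First and last step run along the same edge in opposite directions; without them a closed
    -- reduced walk of length `suc k` based at `u 1` remains.
    edge-not-reused u c walk red (suc k) i<g (inj₂ _) | u≡ , c≡ | inj₂ refl =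
      free (u ∘ suc) (c ∘ suc) k (s≤s (m≤n⇒m≤1+n (n<1+n k)))
           (λ j j<k → walk (suc j) (s<s (m≤n⇒m≤1+n j<k)))
           (λ j j<k → red (suc j) (s<s (m≤n⇒m≤1+n j<k)))
           u₁≡
      where
      u₁≡ : u 1 ≡ u (suc (suc k))
      u₁≡ = begin
        u 1                                              ≡⟨ walk 0 z<s ⟩
        move (c 0) (u 0)                                 ≡⟨ cong₂ move c≡ u≡ ⟩
        move (c (2 + k)) (move (c (2 + k)) (u (2 + k)))  ≡⟨ move-involutive _ _ ⟩
        u (2 + k)                                        ∎
        where open ≡-Reasoning

    cover-free : Freeᶜ (suc (suc g))
    cover-free u c n n<g walk red closed with m≤n⇒m<n∨m≡n (s<s⁻¹ n<g)
    -- Projection keeps the colours, so a shorter closed reduced walk would already exist in `H`.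
    ... | inj₁ n<1+g = free (point ∘ u) c n n<1+g (point-walk walk) red (cong point closed)
    -- At length exactly `suc g`, closedness would restore the bit of the first edge, although only
    -- the first step toggles it.
    ... | inj₂ refl = toggle-yes (onEdge? (c 0) (point (u 0)) e) (inj₁ refl) (bits (u 0) e)
                        (begin
                          toggleEdge (c 0) (point (u 0)) (bits (u 0)) e  ≡⟨ bit-step 0 z<s ⟨
                          bits (u 1) e                                   ≡⟨ constant g ≤-refl ⟨
                          bits (u (suc g)) e                             ≡⟨ cong (λ x → bits x e) closed ⟨
                          bits (u 0) e                                   ∎)
      where
      open ≡-Reasoning
      e : Fin (order * r)
      e = combine (point (u 0)) (c 0)

      bit-step : ∀ i → i < suc g → bits (u (suc i)) e ≡ toggleEdge (c i) (point (u i)) (bits (u i)) e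
      bit-step i i<n = trans (cong (λ x → bits x e) (walk i i<n)) (bits-coverMove (c i) (u i) e)

      constant : ∀ i → i ≤ g → bits (u (suc i)) e ≡ bits (u 1) e
      constant zero    _   = refl
      constant (suc i) i<g = begin
        bits (u (2 + i)) e                                                      ≡⟨ bit-step (suc i) (s<s i<g) ⟩
        toggleEdge (c (suc i)) (point (u (suc i))) (bits (u (suc i))) e
          ≡⟨ toggle-no (onEdge? (c (suc i)) (point (u (suc i))) e)
               (edge-not-reused (point ∘ u) c (point-walk walk) red i i<g) _ ⟩
        bits (u (suc i)) e                                                      ≡⟨ constant i (<⇒≤ i<g) ⟩
        bits (u 1) e                                                            ∎

-- Iterating the cover

freeInvolutions : ∀ r g → ∃ λ (H : Involutions r) → Involutions.Free H (suc g)
-- `Free 1` is vacuous, as no positive length is below 1, so the loops of the one-point graph do no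
-- harm.
freeInvolutions r zero    = trivial , λ { _ _ _ (s≤s ()) }
  where
  trivial : Involutions r
  trivial = record
    { order = 1 ; basepoint = zero ; move = λ _ v → v ; move-involutive = λ _ _ → refl }
freeInvolutions r (suc g) with freeInvolutions r g
... | H , free = cover H , cover-free H free

-- Counting the elements of a Boolean subset

elementAt : ∀ {n} (p : Fin n → Bool) → Fin ∣ tabulate p ∣ → Fin n
elementAt {suc n} p i with p zero
elementAt {suc n} p zero    | true  = zero
elementAt {suc n} p (suc i) | true  = suc (elementAt (p ∘ suc) i)
elementAt {suc n} p i       | false = suc (elementAt (p ∘ suc) i)

elementAt-satisfies : ∀ {n} (p : Fin n → Bool) i → T (p (elementAt p i))
elementAt-satisfies {suc n} p i with p zero in eq
elementAt-satisfies {suc n} p zero    | true  = subst T (sym eq) tt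
elementAt-satisfies {suc n} p (suc i) | true  = elementAt-satisfies (p ∘ suc) i
elementAt-satisfies {suc n} p i       | false = elementAt-satisfies (p ∘ suc) i

elementAt-injective : ∀ {n} (p : Fin n → Bool) → Injective _≡_ _≡_ (elementAt p)
elementAt-injective {suc n} p {i} {j} eq with p zero
elementAt-injective {suc n} p {zero}  {zero}  eq | true  = refl
elementAt-injective {suc n} p {suc i} {suc j} eq | true  = cong suc (elementAt-injective (p ∘ suc) (suc-injective eq))
elementAt-injective {suc n} p {i}     {j}     eq | false = elementAt-injective (p ∘ suc) (suc-injective eq)

rank : ∀ {n} (p : Fin n → Bool) v → T (p v) → Fin ∣ tabulate p ∣
rank {suc n} p zero    t with p zero
... | true = zero
rank {suc n} p (suc v) t with p zero
... | true  = suc (rank (p ∘ suc) v t)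
... | false = rank (p ∘ suc) v t

elementAt-rank : ∀ {n} (p : Fin n → Bool) v t → elementAt p (rank p v t) ≡ v
elementAt-rank {suc n} p zero    t with p zero
... | true = refl
elementAt-rank {suc n} p (suc v) t with p zero
... | true  = cong suc (elementAt-rank (p ∘ suc) v t)
... | false = cong suc (elementAt-rank (p ∘ suc) v t)

-- Injections in both directions force equal sizes: one sends each listed element to a preimage
-- under `f`, the other sends `i` to the rank of `f i`.
∣tabulate∣≡ : ∀ {m n} (p : Fin n → Bool) (f : Fin m → Fin n) → Injective _≡_ _≡_ f →
              (∀ i → T (p (f i))) → (∀ v → T (p v) → ∃ λ i → f i ≡ v) → ∣ tabulate p ∣ ≡ m
∣tabulate∣≡ p f f-inj sound complete = ≤-antisym (injective⇒≤ index-injective) (injective⇒≤ rank∘f-injective)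
  where
  index = λ j → complete (elementAt p j) (elementAt-satisfies p j)

  index-injective : Injective _≡_ _≡_ (proj₁ ∘ index)
  index-injective {i} {j} eq = elementAt-injective p
    (trans (sym (proj₂ (index i))) (trans (cong f eq) (proj₂ (index j))))

  rank∘f-injective : Injective _≡_ _≡_ (λ i → rank p (f i) (sound i))
  rank∘f-injective {i} {j} eq = f-inj
    (trans (sym (elementAt-rank p (f i) (sound i)))
      (trans (cong (elementAt p) eq) (elementAt-rank p (f j) (sound j))))

⌊⌋-cong : ∀ {a b} {A : Set a} {B : Set b} (A? : Dec A) (B? : Dec B) → (A → B) → (B → A) → ⌊ A? ⌋ ≡ ⌊ B? ⌋
⌊⌋-cong A? B? to from = trans (isYes≗does A?) (trans (does-⇔ (mk⇔ to from) A? B?) (sym (isYes≗does B?)))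

⌊⌋-false : ∀ {a} {A : Set a} (A? : Dec A) → ¬ A → ⌊ A? ⌋ ≡ false
⌊⌋-false A? ¬A = trans (isYes≗does A?) (dec-false A? ¬A)

-- Cyclic levels and winding numbers

cyclicPred : ∀ {n} → Fin (suc n) → Fin (suc n)
cyclicPred zero    = fromℕ _
cyclicPred (suc i) = inject₁ i

cyclicSuc : ∀ {n} → Fin (suc n) → Fin (suc n)
cyclicSuc i with view i
... | ‵fromℕ     = zero
... | ‵inject₁ j = suc j

cyclicPred-suc : ∀ {n} (i : Fin (suc n)) → cyclicPred (cyclicSuc i) ≡ i
cyclicPred-suc i with view i
... | ‵fromℕ     = refl
... | ‵inject₁ j = refl

cyclicPred-injective : ∀ {n} → Injective _≡_ _≡_ (cyclicPred {n})
cyclicPred-injective {_} {zero}  {zero}  eq = refl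
cyclicPred-injective {_} {zero}  {suc j} eq = contradiction eq fromℕ≢inject₁
cyclicPred-injective {_} {suc i} {zero}  eq = contradiction (sym eq) fromℕ≢inject₁
cyclicPred-injective {_} {suc i} {suc j} eq = cong suc (inject₁-injective eq)

inject₁≢suc : ∀ {n} (i : Fin n) → inject₁ i ≢ suc i
inject₁≢suc (suc i) eq = inject₁≢suc i (suc-injective eq)

cyclicPred-≢ : ∀ {n} (i : Fin (2 + n)) → i ≢ cyclicPred i
cyclicPred-≢ zero    ()
cyclicPred-≢ (suc i) eq = inject₁≢suc i (sym eq)

module _ {m : ℕ} where

  -- a counts the steps for which E fails, and q how often the level wraps around.
  level-sum : ∀ n (l : Fin (suc n) → Fin (suc m)) (E : Fin n → Set) →
              (∀ i → (E i × l (inject₁ i) ≡ l (suc i)) ⊎ l (inject₁ i) ≡ cyclicPred (l (suc i))) →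
              ∃₂ λ q a → toℕ (l (fromℕ n)) + q * suc m ≡ toℕ (l zero) + a × a ≤ n × (a ≡ 0 → ∀ i → E i)
  level-sum zero    l E s = 0 , 0 , refl , z≤n , λ _ ()
  level-sum (suc n) l E s with level-sum n (l ∘ suc) (E ∘ suc) (s ∘ suc) | s zero
  ... | q , a , sum , a≤n , all | inj₁ (e , eq) =
    q , a , trans sum (cong (λ x → toℕ x + a) (sym eq)) , m≤n⇒m≤1+n a≤n
      , λ { a≡0 zero → e ; a≡0 (suc i) → all a≡0 i }
  ... | q , a , sum , a≤n , all | inj₂ eq with l (suc zero) | eq
  -- An arc into level zero comes from the top level `m`: the extra wrap contributes `suc m` and the
  -- arc itself one.
  ...   | zero | eq′ = suc q , suc a , total , s≤s a≤n , λ ()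
    where
    open ≡-Reasoning
    x = toℕ (l (fromℕ (suc n)))
    total : x + (suc m + q * suc m) ≡ toℕ (l zero) + suc a
    total = begin
      x + (suc m + q * suc m)   ≡⟨ cong (x +_) (+-comm (suc m) (q * suc m)) ⟩
      x + (q * suc m + suc m)   ≡⟨ +-assoc x (q * suc m) (suc m) ⟨
      x + q * suc m + suc m     ≡⟨ cong (_+ suc m) sum ⟩
      a + suc m                 ≡⟨ +-comm a (suc m) ⟩
      suc m + a                 ≡⟨ +-suc m a ⟨
      m + suc a                 ≡⟨ cong (_+ suc a) (toℕ-fromℕ m) ⟨
      toℕ (fromℕ m) + suc a     ≡⟨ cong (λ y → toℕ y + suc a) eq′ ⟨
      toℕ (l zero) + suc a      ∎
  -- Any other arc raises the level by one without wrapping.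
  ...   | suc i | eq′ = q , suc a , total , s≤s a≤n , λ ()
    where
    open ≡-Reasoning
    total : toℕ (l (fromℕ (suc n))) + q * suc m ≡ toℕ (l zero) + suc a
    total = begin
      toℕ (l (fromℕ (suc n))) + q * suc m  ≡⟨ sum ⟩
      suc (toℕ i) + a                      ≡⟨ +-suc (toℕ i) a ⟨
      toℕ i + suc a                        ≡⟨ cong (_+ suc a) (toℕ-inject₁ i) ⟨
      toℕ (inject₁ i) + suc a              ≡⟨ cong (λ y → toℕ y + suc a) eq′ ⟨
      toℕ (l zero) + suc a                 ∎

  -- Cancelling the equal end levels in `level-sum` leaves `q * suc m ≡ a`. If `q` is zero, no step
  -- fails `E`; otherwise at least `suc m` steps do.
  closed-levels : ∀ n (l : Fin (suc n) → Fin (suc m)) (E : Fin n → Set) →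
                  (∀ i → (E i × l (inject₁ i) ≡ l (suc i)) ⊎ l (inject₁ i) ≡ cyclicPred (l (suc i))) →
                  l zero ≡ l (fromℕ n) → (∀ i → E i) ⊎ suc m ≤ n
  closed-levels n l E s closed with level-sum n l E s
  ... | q , a , sum , a≤n , all
    with +-cancelˡ-≡ (toℕ (l zero)) (q * suc m) a (trans (cong (λ x → toℕ x + q * suc m) closed) sum)
  closed-levels n l E s closed | zero  , a , sum , a≤n , all | eq = inj₁ (all (sym eq))
  closed-levels n l E s closed | suc q , a , sum , a≤n , all | eq =
    inj₂ (≤-trans (m≤m+n (suc m) (q * suc m)) (≤-trans (≤-reflexive eq) a≤n))

-- Saturates at `n`. It turns the `Fin`-indexed data of a cycle into the ℕ-indexed sequences that
-- `Free` speaks about.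
clamp : ∀ n → ℕ → Fin (suc n)
clamp n       zero    = zero
clamp zero    (suc i) = zero
clamp (suc n) (suc i) = suc (clamp n i)

clamp-n : ∀ n → clamp n n ≡ fromℕ n
clamp-n zero    = refl
clamp-n (suc n) = cong suc (clamp-n n)

clamp-inject₁ : ∀ {n i} → i ≤ n → clamp (suc n) i ≡ inject₁ (clamp n i)
clamp-inject₁ z≤n       = refl
clamp-inject₁ (s≤s i≤n) = cong suc (clamp-inject₁ i≤n)

-- The layered mixed graph over `H`

module _ (r z m : ℕ) (H : Involutions r) (free : Involutions.Free H (3 + m)) where
  open Involutions H

  Vertex : Set
  Vertex = Fin ((3 + m) * (suc z * order))

  vertex : Fin (3 + m) → Fin (suc z) → Fin order → Vertex
  vertex l k h = combine l (combine k h)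

  level : Vertex → Fin (3 + m)
  level = quotient (suc z * order)

  rest : Vertex → Fin (suc z * order)
  rest = remainder {3 + m} (suc z * order)

  index : Vertex → Fin (suc z)
  index = quotient order ∘ rest

  height : Vertex → Fin order
  height = remainder {suc z} order ∘ rest

  level-vertex : ∀ l k h → level (vertex l k h) ≡ l
  level-vertex l k h = cong proj₁ (remQuot-combine {3 + m} l (combine k h))

  rest-vertex : ∀ l k h → rest (vertex l k h) ≡ combine k h
  rest-vertex l k h = cong proj₂ (remQuot-combine {3 + m} l (combine k h))

  index-vertex : ∀ l k h → index (vertex l k h) ≡ k
  index-vertex l k h = trans (cong (quotient order) (rest-vertex l k h))
                             (cong proj₁ (remQuot-combine {suc z} k h))

  height-vertex : ∀ l k h → height (vertex l k h) ≡ h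
  height-vertex l k h = trans (cong (remainder {suc z} order) (rest-vertex l k h))
                              (cong proj₂ (remQuot-combine {suc z} k h))

  vertex-coordinates : ∀ v → vertex (level v) (index v) (height v) ≡ v
  vertex-coordinates v = trans (cong (combine (level v)) (combine-remQuot {suc z} order (rest v)))
                               (combine-remQuot {3 + m} (suc z * order) v)

  vertex-injective-index : ∀ l h → Injective _≡_ _≡_ (λ k → vertex l k h)
  vertex-injective-index l h {k} {k′} eq =
    trans (sym (index-vertex l k h)) (trans (cong index eq) (index-vertex l k′ h))

  neighbour : Fin r → Vertex → Vertex
  neighbour c v = vertex (level v) (index v) (move c (height v))

  level-neighbour : ∀ c v → level (neighbour c v) ≡ level v
  level-neighbour c v = level-vertex (level v) (index v) (move c (height v))

  height-neighbour : ∀ c v → height (neighbour c v) ≡ move c (height v)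
  height-neighbour c v = height-vertex (level v) (index v) _

  neighbour-involutive : ∀ c v → neighbour c (neighbour c v) ≡ v
  neighbour-involutive c v
    rewrite level-neighbour c v | index-vertex (level v) (index v) (move c (height v))
          | height-neighbour c v | move-involutive c (height v) = vertex-coordinates v

  -- A fixed point would be a closed reduced walk of length one.
  move-≢ : ∀ c h → h ≢ move c h
  move-≢ c h = free u (λ _ → c) 0 (s<s z<s) (λ { zero _ → refl ; (suc _) (s≤s ()) }) (λ { _ (s≤s ()) })
    where
    u : ℕ → Fin order
    u zero    = h
    u (suc _) = move c h

  -- If different colours `c` and `d` led from `h` to the same vertex, then `c` followed by `d`
  -- would be a closed reduced walk of length two.
  move-injective : ∀ h → Injective _≡_ _≡_ (λ c → move c h)
  move-injective h {c} {d} eq with c ≟ d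
  ... | yes c≡d = c≡d
  ... | no  c≢d = contradiction (trans (sym (move-involutive d h)) (cong (move d) (sym eq)))
    (free u col 1 (s<s (s<s z<s)) walk (λ { zero _ → c≢d ; (suc _) (s≤s (s≤s ())) }))
    where
    u : ℕ → Fin order
    u zero          = h
    u (suc zero)    = move c h
    u (suc (suc _)) = move d (move c h)
    col : ℕ → Fin r
    col zero    = c
    col (suc _) = d
    walk : IsWalk u col 2
    walk zero          _ = refl
    walk (suc zero)    _ = refl
    walk (suc (suc _)) (s≤s (s≤s ()))

  Edge Arc : Vertex → Vertex → Set
  Edge u v = ∃ λ c → neighbour c u ≡ v
  -- Stated through `cyclicPred` of the head, which computes by plain matching, whereas `cyclicSuc`
  -- has to detect the top level.
  Arc  u v = level u ≡ cyclicPred (level v) × height u ≡ height v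

  edge? : ∀ u v → Dec (Edge u v)
  edge? u v = any? λ c → neighbour c u ≟ v

  arc? : ∀ u v → Dec (Arc u v)
  arc? u v = (level u ≟ cyclicPred (level v)) ×-dec (height u ≟ height v)

  Edge-sym : ∀ {u v} → Edge u v → Edge v u
  Edge-sym {u} (c , refl) = c , neighbour-involutive c u

  graph : MixedGraph
  graph = record
    { order       = (3 + m) * (suc z * order)
    ; edge        = λ u v → ⌊ edge? u v ⌋
    ; arc         = λ u v → ⌊ arc? u v ⌋
    ; edge-sym    = λ u v → ⌊⌋-cong (edge? u v) (edge? v u) Edge-sym Edge-sym
    ; edge-irrefl = λ v → ⌊⌋-false (edge? v v) λ (c , eq) →
        move-≢ c (height v) (trans (cong height (sym eq)) (height-neighbour c v))
    ; arc-irrefl  = λ v → ⌊⌋-false (arc? v v) (cyclicPred-≢ (level v) ∘ proj₁)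
    }

  open MixedGraph graph using (outdegree; indegree; degree)

  -- Regularity

  graph-degree : ∀ v → degree v ≡ r
  graph-degree v = ∣tabulate∣≡ _ (λ c → neighbour c v)
    (λ {c} {d} eq → move-injective (height v)
      (trans (sym (height-neighbour c v)) (trans (cong height eq) (height-neighbour d v))))
    (λ c → fromWitness (c , refl))
    (λ w → toWitness)

  graph-outdegree : ∀ v → outdegree v ≡ suc z
  graph-outdegree v = ∣tabulate∣≡ _ (λ k → vertex l⁺ k (height v)) (vertex-injective-index l⁺ (height v))
    (λ k → fromWitness
      ( trans (sym (cyclicPred-suc (level v))) (cong cyclicPred (sym (level-vertex l⁺ k (height v))))
      , sym (height-vertex l⁺ k (height v))))
    (λ w → complete w ∘ toWitness)
    where
    l⁺ = cyclicSuc (level v)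
    complete : ∀ w → Arc v w → ∃ λ k → vertex l⁺ k (height v) ≡ w
    complete w (l , h) = index w , trans
      (cong₂ (λ x y → vertex x (index w) y) l⁺≡ h)
      (vertex-coordinates w)
      where
      l⁺≡ : l⁺ ≡ level w
      l⁺≡ = cyclicPred-injective (trans (cyclicPred-suc (level v)) l)

  graph-indegree : ∀ v → indegree v ≡ suc z
  graph-indegree v = ∣tabulate∣≡ _ (λ k → vertex l⁻ k (height v)) (vertex-injective-index l⁻ (height v))
    (λ k → fromWitness (level-vertex l⁻ k (height v) , height-vertex l⁻ k (height v)))
    (λ w → complete w ∘ toWitness)
    where
    l⁻ = cyclicPred (level v)
    complete : ∀ w → Arc w v → ∃ λ k → vertex l⁻ k (height v) ≡ w
    complete w (l , h) = index w , trans
      (cong₂ (λ x y → vertex x (index w) y) (sym l) (sym h))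
      (vertex-coordinates w)

  -- A cycle once around the levels

  shortCycle : Cycle graph (3 + m)
  shortCycle = record
    { walk = record
      { vertex = v
      ; step   = λ i → along-arc (fromWitness (levels i , heights i)) }
    ; positive         = s≤s z≤n
    -- The last index is `suc (fromℕ (2 + m))`, whose level computes to the top level, where the
    -- cycle starts.
    ; closed           = refl
    ; vertex-injective = v-injective
    ; links-distinct   = λ i j i≢j (u≡ , _) → i≢j (v-injective u≡)
    }
    where
    -- Starting at the top level makes the levels a definitional solution of the
    -- arc condition.
    l : Fin (4 + m) → Fin (3 + m)
    l zero    = fromℕ (2 + m)
    l (suc i) = i

    l-inject₁ : ∀ i → l (inject₁ i) ≡ cyclicPred i
    l-inject₁ zero    = refl
    l-inject₁ (suc i) = refl

    v : Fin (4 + m) → Vertex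
    v i = vertex (l i) zero basepoint

    level-v : ∀ i → level (v i) ≡ l i
    level-v i = level-vertex (l i) zero basepoint

    levels : ∀ i → level (v (inject₁ i)) ≡ cyclicPred (level (v (suc i)))
    levels i = trans (level-v (inject₁ i)) (trans (l-inject₁ i) (cong cyclicPred (sym (level-v (suc i)))))

    heights : ∀ i → height (v (inject₁ i)) ≡ height (v (suc i))
    heights i = trans (height-vertex (l (inject₁ i)) zero basepoint) (sym (height-vertex i zero basepoint))

    v-injective : Injective _≡_ _≡_ (λ i → v (inject₁ i))
    v-injective {i} {j} eq = cyclicPred-injective
      (trans (sym (levelᵛ i)) (trans (cong level eq) (levelᵛ j)))
      where
      levelᵛ : ∀ i → level (v (inject₁ i)) ≡ cyclicPred i
      levelᵛ i = trans (level-v (inject₁ i)) (l-inject₁ i)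

  -- Lower bound for the girth

  IsEdgeStep : ∀ {u v} → Step graph u v → Set
  IsEdgeStep s = ∃ λ t → s ≡ along-edge t

  step-levels : ∀ {u v} (s : Step graph u v) →
                (IsEdgeStep s × level u ≡ level v) ⊎ level u ≡ cyclicPred (level v)
  step-levels {u} (along-edge t) with toWitness t
  ... | c , refl = inj₁ ((t , refl) , sym (level-neighbour c u))
  step-levels (along-arc t) = inj₂ (proj₁ (toWitness t))

  -- The equations in `IsEdgeStep` expose both steps as edge steps, so that `SameLink` computes; its
  -- second alternative is traversal in reverse.
  backtrack : ∀ {u v u′ v′} (s : Step graph u v) (s′ : Step graph u′ v′) → IsEdgeStep s → IsEdgeStep s′ →
              u ≡ v′ → v ≡ u′ → SameLink graph s s′
  backtrack _ _ (_ , refl) (_ , refl) u≡ v≡ = inj₂ (u≡ , v≡)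

  -- The heights along such a cycle form a closed reduced walk in `H`, which `free` excludes below
  -- length `3 + m`.
  edge-cycle-long : ∀ n (C : Cycle graph n) → (∀ i → IsEdgeStep (Cycle.step C i)) → ¬ (n < 3 + m)
  edge-cycle-long zero    C _  _   = contradiction (Cycle.positive C) λ ()
  edge-cycle-long (suc n) C es n<g = free u (colour ∘ clamp n) n n<g walk reduced ends
    where
    open Cycle C using (step; links-distinct; closed) renaming (vertex to v)

    colours : ∀ i → Edge (v (inject₁ i)) (v (suc i))
    colours i = toWitness (proj₁ (es i))

    colour : Fin (suc n) → Fin r
    colour = proj₁ ∘ colours

    u : ℕ → Fin order
    u i = height (v (clamp (suc n) i))

    walk : IsWalk u (colour ∘ clamp n) (suc n)
    walk i (s≤s i≤n) rewrite clamp-inject₁ i≤n =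
      trans (cong height (sym (proj₂ (colours (clamp n i)))))
            (height-neighbour (colour (clamp n i)) (v (inject₁ (clamp n i))))

    -- Equal colours on consecutive steps would lead straight back over the same edge, which a cycle
    -- may not use twice.
    colour-≢ : ∀ i j → inject₁ j ≡ suc i → i ≢ j → colour i ≢ colour j
    colour-≢ i j adjacent i≢j eq = links-distinct i j i≢j
      (backtrack (step i) (step j) (es i) (es j) returns (cong v (sym adjacent)))
      where
      open ≡-Reasoning
      returns : v (inject₁ i) ≡ v (suc j)
      returns = begin
        v (inject₁ i)                                              ≡⟨ neighbour-involutive (colour i) _ ⟨
        neighbour (colour i) (neighbour (colour i) (v (inject₁ i))) ≡⟨ cong (neighbour (colour i)) (proj₂ (colours i)) ⟩
        neighbour (colour i) (v (suc i))                           ≡⟨ cong₂ neighbour eq (cong v (sym adjacent)) ⟩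
        neighbour (colour j) (v (inject₁ j))                       ≡⟨ proj₂ (colours j) ⟩
        v (suc j)                                                  ∎

    clamp-adjacent : ∀ {k} i → suc i < suc k →
                     inject₁ (clamp k (suc i)) ≡ suc (clamp k i) × clamp k i ≢ clamp k (suc i)
    clamp-adjacent {suc k} i (s≤s (s≤s i≤k)) rewrite clamp-inject₁ i≤k = refl , inject₁≢suc (clamp k i)

    reduced : IsReduced (colour ∘ clamp n) (suc n)
    reduced i i<n = uncurry (colour-≢ (clamp n i) (clamp n (suc i))) (clamp-adjacent i i<n)

    ends : u 0 ≡ u (suc n)
    ends = cong height (trans closed (cong v (sym (clamp-n (suc n)))))

  cycle-long : ∀ n → Cycle graph n → 3 + m ≤ n
  cycle-long n C with 3 + m ≤? n
  ... | yes g≤n = g≤n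
  ... | no  g≰n with closed-levels n (level ∘ Cycle.vertex C) (λ i → IsEdgeStep (Cycle.step C i))
                       (λ i → step-levels (Cycle.step C i)) (cong level (Cycle.closed C))
  ...   | inj₁ es  = contradiction (≰⇒> g≰n) (edge-cycle-long n C es)
  ...   | inj₂ g≤n = g≤n

  graph-isMixedGraph : IsMixedGraph[ suc z , r ⨾ 3 + m ] graph
  graph-isMixedGraph = record
    { out-regular  = graph-outdegree
    ; in-regular   = graph-indegree
    ; edge-regular = graph-degree
    ; girth        = shortCycle , cycle-long
    }

theorem1 : (z r g : ℕ) → z ≥ 1 → r ≥ 1 → g ≥ 3 → ∃ (λ (G : MixedGraph) → IsMixedGraph[ z , r ⨾ g ] G)
-- The argument `2 + m` yields `Free (3 + m)`, which excludes exactly the lengths below the girth.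
theorem1 (suc z) r (suc (suc (suc m))) (s≤s _) _ (s≤s (s≤s (s≤s _))) with freeInvolutions r (2 + m)
... | H , free = graph r z m H free , graph-isMixedGraph r z m H free
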